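{- Hitting Set is polynomial-time solvable on set systems $\mathcal F$ of VC-dimension $1$ (i.e. $VC(\mathcal F)=1$) and on set systems $\mathcal F$ of dual VC-dimension $1$ (i.e. $VC(\mathcal F^T)=1$).
   Context: A set system is a pair $\mathcal F=(X,\mathcal C)$ where $X$ is a finite set and $\mathcal C$ is a collection of subsets of $X$. A hitting set of $(X,\mathcal C)$ is a subset of $X$ that has non-empty intersection with every member of $\mathcal C$. The (decision) problem Hitting Set asks, given a set system and a positive integer $k$, whether the set system has a hitting set of size at most $k$. The incidence matrix of $\mathcal F$ is the $0/1$ matrix with rows indexed by the members of $\mathcal C$ and columns indexed by the elements of $X$, with entry $(A,x)$ equal to $1$ if $x\in A$ and $0$ otherwise. The dual set system $\mathcal F^T$ is the set system obtained by transposing the incidence matrix, i.e. by interchanging the roles of elements and sets (duplicate rows of the transposed matrix are discarded). For $A\subseteq X$, the projection of $\mathcal F$ on $A$ is $PR_{\mathcal F}(A)=\{R\cap A \mid R\in\mathcal C\}$. The set $A$ is shattered by $\mathcal F$ if $PR_{\mathcal F}(A)=2^A$ (the set of all subsets of $A$). The VC-dimension $VC(\mathcal F)$ is the cardinality of the largest set shattered by $\mathcal F$; $VC(\mathcal F^T)$ is the dual VC-dimension. -}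

module Defs where

open import Data.Bool using (Bool; true; false)
open import Data.Bool.Properties using () renaming (_≟_ to _≟ᵇ_)
open import Data.Fin using (Fin; zero)
open import Data.Fin.Subset using (Subset; _⊆_; _∩_; ∣_∣; Nonempty)
open import Data.List using (List; foldr; length; deduplicate)
import Data.List as List
open import Data.List.Membership.Propositional using (_∈_)
open import Data.List.Relation.Unary.Unique.Propositional using (Unique)
import Data.List.Relation.Unary.Unique.DecPropositional.Properties as Unique
open import Data.Nat using (ℕ; suc; _+_; _*_; _^_; _≤_; NonZero)
open import Data.Nat.Binary using (ℕᵇ; 2[1+_]; 1+[2_])
import Data.Nat.Binary as ℕᵇ
open import Data.Product using (_×_; _,_; ∃; ∃-syntax)
open import Data.Vec using (Vec; lookup; fromList; toList; replicate; _[_]≔_)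
import Data.Vec as Vec
open import Data.Vec.Properties using (≡-dec)
open import Function using (_∘_; _⇔_)
open import Relation.Binary.Definitions using (DecidableEquality)
open import Relation.Binary.PropositionalEquality using (_≡_; _≢_)
open import Relation.Nullary using (Reflects)

------------------------------------------------------------------------
-- Set systems

-- The ground set is Fin points; the collection is listed without repetition,
-- so the list of vectors is literally the incidence matrix.

record SetSystem : Set where
  field
    points : ℕ
    sets   : List (Subset points)
    unique : Unique sets

open SetSystem public

_≟ˢ_ : ∀ {n} → DecidableEquality (Subset n)
_≟ˢ_ = ≡-dec _≟ᵇ_

column : (F : SetSystem) → Fin (points F) → Subset (length (sets F))
column F x = Vec.map (λ A → lookup A x) (fromList (sets F))

dual : SetSystem → SetSystem
dual F = record
  { points = length (sets F)
  ; sets   = deduplicate _≟ˢ_ columns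
  ; unique = Unique.deduplicate-! _≟ˢ_ columns
  }
  where
  columns : List (Subset (length (sets F)))
  columns = List.tabulate (column F)

Projection : (F : SetSystem) → Subset (points F) → Subset (points F) → Set
Projection F A B = ∃[ R ] R ∈ sets F × B ≡ R ∩ A

Shattered : (F : SetSystem) → Subset (points F) → Set
Shattered F A = ∀ B → Projection F A B ⇔ B ⊆ A

-- A relation rather than a function: when the collection is empty, not even
-- the empty set is shattered, and the VC-dimension is undefined.

HasVCDimension : SetSystem → ℕ → Set
HasVCDimension F d =
  (∃[ A ] Shattered F A × ∣ A ∣ ≡ d) × (∀ A → Shattered F A → ∣ A ∣ ≤ d)

IsHittingSet : (F : SetSystem) → Subset (points F) → Set
IsHittingSet F H = ∀ A → A ∈ sets F → Nonempty (H ∩ A)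

------------------------------------------------------------------------
-- Model of computation: the language WHILE of N. D. Jones, "Computability
-- and Complexity from a Programming Perspective" (MIT Press, 1997), without
-- its equality test, and with its unit-cost measure.
--
-- A store holds finitely many variables whose values are binary trees.
-- Charging one step for cons, hd and tl is legitimate although x := cons x x
-- doubles the size of a tree: with shared subtrees (values are pointers to
-- cons cells) each operation is constant-time on a RAM, and t steps allocate
-- at most t cells.  Polynomial time for this language therefore coincides
-- with polynomial time for Turing machines.

infixr 5 _∙_

data Tree : Set where
  nil : Tree
  _∙_ : Tree → Tree → Tree

size : Tree → ℕ
size nil     = 1
size (a ∙ b) = suc (size a + size b)

head tail : Tree → Tree
head nil     = nil
head (a ∙ b) = a
tail nil     = nil
tail (a ∙ b) = b

data Exp (v : ℕ) : Set where
  var   : Fin v → Exp v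
  nil   : Exp v
  cons  : Exp v → Exp v → Exp v
  hd tl : Exp v → Exp v

infix  6 _:=_
infixr 5 _⨾_

data Command (v : ℕ) : Set where
  _:=_          : Fin v → Exp v → Command v
  _⨾_           : Command v → Command v → Command v
  if_then_else_ : Exp v → Command v → Command v → Command v
  while_repeat_ : Exp v → Command v → Command v

Store : ℕ → Set
Store = Vec Tree

private
  variable
    v t t₁ t₂ : ℕ
    σ σ₁ σ₂   : Store v
    e         : Exp v
    c c₁ c₂   : Command v

eval : Exp v → Store v → Tree
eval (var x)      σ = lookup σ x
eval nil          σ = nil
eval (cons e₁ e₂) σ = eval e₁ σ ∙ eval e₂ σ
eval (hd e)       σ = head (eval e σ)
eval (tl e)       σ = tail (eval e σ)

cost : Exp v → ℕ
cost (var x)      = 1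
cost nil          = 1
cost (cons e₁ e₂) = suc (cost e₁ + cost e₂)
cost (hd e)       = suc (cost e)
cost (tl e)       = suc (cost e)

infix 4 ⟨_,_⟩⇓⟨_,_⟩

-- ⟨ c , σ ⟩⇓⟨ σ′ , t ⟩: started in store σ, the command c terminates in
-- store σ′ after t steps.  In tests, nil is false and every pair is true.

data ⟨_,_⟩⇓⟨_,_⟩ {v : ℕ} : Command v → Store v → Store v → ℕ → Set where
  assign     : ∀ {x} →
               ⟨ x := e , σ ⟩⇓⟨ σ [ x ]≔ eval e σ , suc (cost e) ⟩
  seq        : ⟨ c₁ , σ ⟩⇓⟨ σ₁ , t₁ ⟩ → ⟨ c₂ , σ₁ ⟩⇓⟨ σ₂ , t₂ ⟩ →
               ⟨ c₁ ⨾ c₂ , σ ⟩⇓⟨ σ₂ , t₁ + t₂ ⟩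
  if-true    : eval e σ ≢ nil → ⟨ c₁ , σ ⟩⇓⟨ σ₁ , t ⟩ →
               ⟨ if e then c₁ else c₂ , σ ⟩⇓⟨ σ₁ , suc (cost e) + t ⟩
  if-false   : eval e σ ≡ nil → ⟨ c₂ , σ ⟩⇓⟨ σ₁ , t ⟩ →
               ⟨ if e then c₁ else c₂ , σ ⟩⇓⟨ σ₁ , suc (cost e) + t ⟩
  while-true : eval e σ ≢ nil → ⟨ c , σ ⟩⇓⟨ σ₁ , t₁ ⟩ →
               ⟨ while e repeat c , σ₁ ⟩⇓⟨ σ₂ , t₂ ⟩ →
               ⟨ while e repeat c , σ ⟩⇓⟨ σ₂ , suc (cost e) + (t₁ + t₂) ⟩
  while-false : eval e σ ≡ nil →
               ⟨ while e repeat c , σ ⟩⇓⟨ σ , suc (cost e) ⟩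

-- The variable zero receives the input and returns the output; all other
-- variables start as nil.

record Program : Set where
  field
    auxiliaries : ℕ
    body        : Command (suc auxiliaries)

Runs : Program → Tree → Tree → ℕ → Set
Runs P input output t =
  ∃[ σ ] ⟨ body , input Vec.∷ replicate auxiliaries nil ⟩⇓⟨ σ , t ⟩
         × lookup σ zero ≡ output
  where open Program P

------------------------------------------------------------------------
-- Decision problems and polynomial time

encodeBool : Bool → Tree
encodeBool false = nil
encodeBool true  = nil ∙ nil

encodeList : ∀ {A : Set} → (A → Tree) → List A → Tree
encodeList f = foldr (λ a d → f a ∙ d) nil

encodeℕᵇ : ℕᵇ → Tree
encodeℕᵇ ℕᵇ.zero  = nil
encodeℕᵇ 2[1+ b ] = encodeBool false ∙ encodeℕᵇ b
encodeℕᵇ 1+[2 b ] = encodeBool true ∙ encodeℕᵇ b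

-- Numbers are written in binary.

encodeℕ : ℕ → Tree
encodeℕ = encodeℕᵇ ∘ ℕᵇ.fromℕ

-- The ground set is written out as a list with one entry per point, so that
-- it is not lost when the incidence matrix has no rows.

encodeSetSystem : SetSystem → Tree
encodeSetSystem F =
  encodeList (λ _ → nil) (List.allFin (points F)) ∙
  encodeList (encodeList encodeBool ∘ toList) (sets F)

record DecisionProblem : Set₁ where
  field
    Instance : Set
    encode   : Instance → Tree
    Yes      : Instance → Set

-- A single program decides every instance satisfying the promise; nothing is
-- required of it on other inputs.

PolynomialTimeSolvableOn :
  (Π : DecisionProblem) → (DecisionProblem.Instance Π → Set) → Set
PolynomialTimeSolvableOn Π Promise =
  ∃[ P ] ∃[ a ] ∃[ k ] ∀ I → Promise I →
    ∃[ b ] ∃[ t ] Runs P (encode I) (encodeBool b) t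
                × t ≤ a * size (encode I) ^ k + a
                × Reflects (Yes I) b
  where open DecisionProblem Π

record HittingSetInstance : Set where
  field
    system       : SetSystem
    bound        : ℕ
    .{{bound≢0}} : NonZero bound

open HittingSetInstance public using (system; bound)

HittingSet : DecisionProblem
HittingSet = record
  { Instance = HittingSetInstance
  ; encode   = λ I → encodeSetSystem (system I) ∙ encodeℕ (bound I)
  ; Yes      = λ I → ∃[ H ] IsHittingSet (system I) H × ∣ H ∣ ≤ bound I
  }

{-# OPTIONS --safe #-}
module Submission where

-- If no set is empty and no pair of points hits every set, then in both cases
-- any minimal set A has a point y lying in all the minimal sets that meet A.
-- VC-dimension 1: take y in A such that the family of sets containing y is
-- maximal.  If a set contains x in A but not y, then the patterns 11, 10 and
-- 00 occur on {x , y}, so 01 does not, against maximality.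
-- Dual VC-dimension 1: any y in A will do, as distinct minimal sets A and R
-- are disjoint.  Otherwise A ∪ R is everything, and with a ∈ A ∖ R and
-- r ∈ R ∖ A every minimal C contains a or r: else C and R do not cover a,
-- hence are disjoint, and C ⊂ A.
-- So a greedy maximal packing of minimal sets has as many members as a
-- minimum hitting set, and it is enough to look for hitting sets with one or
-- two points first and to count this packing if there are none.

open import Defs
open import Data.Bool using (Bool; true; false; _∨_)
open import Data.Empty using (⊥)
open import Data.Fin using (Fin; zero; suc; toℕ; fromℕ<) renaming (_≟_ to _≟ᶠ_)
open import Data.Fin.Properties using (toℕ<n; toℕ-fromℕ<; toℕ-injective)
import Data.Fin.Properties as Fin
open import Data.Fin.Subset
  using (Subset; _∩_; _∪_; _-_; ⁅_⁆; ∣_∣; Nonempty; _⊆_; _⊂_)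
  renaming (_∈_ to _∈ˢ_; _∉_ to _∉ˢ_; ⊥ to ∅)
open import Data.Fin.Subset.Properties
  using ( ∣⊥∣≡0; x∈⁅x⁆; x∈⁅y⁆⇒x≡y; ∣⁅x⁆∣≡1; x∈p∩q⁺; x∈p∩q⁻; p∩q⊆q; x∈p∪q⁻; x∈p∪q⁺; ∪-idem
        ; ∣p∣≤∣x∷p∣; x∈p∧x≢y⇒x∈p-y; x∈p⇒∣p-x∣<∣p∣; ⊆-antisym; drop-there; _∈?_; _⊆?_; nonempty?)
open import Data.List using (List; []; _∷_; length; filter; allFin)
import Data.List as List
open import Data.List.Membership.Propositional using (_∈_; find; lose)
open import Data.List.Membership.Propositional.Properties
  using (∈-filter⁺; ∈-filter⁻; ∈-allFin; ∈-deduplicate⁺; ∈-tabulate⁺)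
open import Data.List.Relation.Unary.All as All using (All; []; _∷_; all?)
open import Data.List.Relation.Unary.All.Properties using (¬Any⇒All¬)
open import Data.List.Relation.Unary.AllPairs using (AllPairs; []; _∷_)
open import Data.List.Relation.Unary.Any using (Any; here; there; index; any?)
open import Data.List.Relation.Unary.Any.Properties using (lookup-index)
open import Data.Nat
  using ( ℕ; zero; suc; _+_; _*_; _∸_; _^_; _≤_; _<_; _≤?_; NonZero; z≤n; s≤s; s≤s⁻¹
        ; >-nonZero⁻¹; ⌊_/2⌋; ⌈_/2⌉)
open import Data.Nat.Binary using (2[1+_]; 1+[2_])
import Data.Nat.Binary as ℕᵇ
import Data.Nat.Binary.Properties as ℕᵇ
open import Data.Nat.Properties
open import Data.Product using (_×_; _,_; ∃; ∃-syntax; proj₁; proj₂)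
open import Data.Sum using (_⊎_; inj₁; inj₂)
open import Data.Vec using ([]; _∷_; here; there; fromList; lookup; toList)
import Data.Vec as Vec
open import Data.Vec.Properties using ([]=⇒lookup; lookup⇒[]=)
open import Function using (_∘_; id; case_of_; mk⇔)
open import Relation.Binary.Definitions using (Decidable; Transitive)
open import Relation.Binary.PropositionalEquality
  using (_≡_; _≢_; refl; sym; trans; cong; cong₂; subst)
open import Relation.Nullary
  using (¬_; Reflects; ofʸ; ofⁿ; contradiction; decidable-stable; yes; no)
open import Relation.Nullary.Decidable using (_→-dec_; _×-dec_; ¬?)
open import Relation.Nullary.Reflects using (¬-reflects; _×-reflects_; _⊎-reflects_)

private
  variable
    n : ℕ

-- Polynomial-time programs

infixl 6 _⊕_
infixl 7 _⊗_
infixr 9 _⊙_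

-- Kept as syntax, so that coefficient and exponent of the final bound can be computed by recursion;
-- composition is a constructor for the sake of `_⨟_`.
data Poly : Set where
  X           : Poly
  const       : ℕ → Poly
  _⊕_ _⊗_ _⊙_ : Poly → Poly → Poly

⟦_⟧ : Poly → ℕ → ℕ
⟦ X ⟧       n = n
⟦ const c ⟧ n = c
⟦ p ⊕ q ⟧   n = ⟦ p ⟧ n + ⟦ q ⟧ n
⟦ p ⊗ q ⟧   n = ⟦ p ⟧ n * ⟦ q ⟧ n
⟦ p ⊙ q ⟧   n = ⟦ p ⟧ (⟦ q ⟧ n)

⟦⟧-mono : ∀ p {m n} → m ≤ n → ⟦ p ⟧ m ≤ ⟦ p ⟧ n
⟦⟧-mono X         m≤n = m≤n
⟦⟧-mono (const c) m≤n = ≤-refl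
⟦⟧-mono (p ⊕ q)   m≤n = +-mono-≤ (⟦⟧-mono p m≤n) (⟦⟧-mono q m≤n)
⟦⟧-mono (p ⊗ q)   m≤n = *-mono-≤ (⟦⟧-mono p m≤n) (⟦⟧-mono q m≤n)
⟦⟧-mono (p ⊙ q)   m≤n = ⟦⟧-mono p (⟦⟧-mono q m≤n)

^-distribʳ-* : ∀ k m n → (m * n) ^ k ≡ m ^ k * n ^ k
^-distribʳ-* zero    m n = refl
^-distribʳ-* (suc k) m n = trans (cong (m * n *_) (^-distribʳ-* k m n))
  ([m*n]*[o*p]≡[m*o]*[n*p] m n (m ^ k) (n ^ k))

-- The coefficient is kept positive so that the bound for q can be plugged
-- into the bound for p, which is only valid from 1 onwards.
⟦⟧-monomial : ∀ p → ∃[ a ] ∃[ k ] ∀ n → 1 ≤ n → ⟦ p ⟧ n ≤ suc a * n ^ k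
⟦⟧-monomial X         = 0 , 1 , λ n _ → ≤-reflexive (sym (trans (*-identityˡ (n ^ 1)) (^-identityʳ n)))
⟦⟧-monomial (const c) = c , 0 , λ n _ → ≤-trans (n≤1+n c) (≤-reflexive (sym (*-identityʳ (suc c))))
⟦⟧-monomial (p ⊕ q) with ⟦⟧-monomial p | ⟦⟧-monomial q
... | a , k , p≤ | b , l , q≤ = a + suc b , k + l , λ
  { n@(suc _) 1≤n → begin
    ⟦ p ⟧ n + ⟦ q ⟧ n                          ≤⟨ +-mono-≤ (p≤ n 1≤n) (q≤ n 1≤n) ⟩
    suc a * n ^ k + suc b * n ^ l              ≤⟨ +-mono-≤ (*-monoʳ-≤ (suc a) (^-monoʳ-≤ n (m≤m+n k l)))
                                                           (*-monoʳ-≤ (suc b) (^-monoʳ-≤ n (m≤n+m l k))) ⟩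
    suc a * n ^ (k + l) + suc b * n ^ (k + l)  ≡⟨ *-distribʳ-+ (n ^ (k + l)) (suc a) (suc b) ⟨
    suc (a + suc b) * n ^ (k + l)              ∎ }
  where open ≤-Reasoning
⟦⟧-monomial (p ⊗ q) with ⟦⟧-monomial p | ⟦⟧-monomial q
... | a , k , p≤ | b , l , q≤ = b + a * suc b , k + l , λ n 1≤n → begin
  ⟦ p ⟧ n * ⟦ q ⟧ n                    ≤⟨ *-mono-≤ (p≤ n 1≤n) (q≤ n 1≤n) ⟩
  suc a * n ^ k * (suc b * n ^ l)      ≡⟨ [m*n]*[o*p]≡[m*o]*[n*p] (suc a) (n ^ k) (suc b) (n ^ l) ⟩
  suc a * suc b * (n ^ k * n ^ l)      ≡⟨ cong (suc a * suc b *_) (^-distribˡ-+-* n k l) ⟨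
  suc a * suc b * n ^ (k + l)          ∎
  where open ≤-Reasoning
⟦⟧-monomial (p ⊙ q) with ⟦⟧-monomial p | ⟦⟧-monomial q
-- The coefficient exceeds the product by one, which saves exhibiting the product as a successor.
... | a , k , p≤ | b , l , q≤ = suc a * suc b ^ k , l * k , λ
  { n@(suc _) 1≤n → begin
    ⟦ p ⟧ (⟦ q ⟧ n)                          ≤⟨ ⟦⟧-mono p (q≤ n 1≤n) ⟩
    ⟦ p ⟧ (suc b * n ^ l)                    ≤⟨ p≤ _ (*-mono-≤ {1} {suc b} {1} (s≤s z≤n) (m^n>0 n l)) ⟩
    suc a * (suc b * n ^ l) ^ k              ≡⟨ cong (suc a *_) (^-distribʳ-* k (suc b) (n ^ l)) ⟩
    suc a * (suc b ^ k * (n ^ l) ^ k)        ≡⟨ *-assoc (suc a) (suc b ^ k) _ ⟨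
    suc a * suc b ^ k * (n ^ l) ^ k          ≡⟨ cong (suc a * suc b ^ k *_) (^-*-assoc n l k) ⟩
    suc a * suc b ^ k * n ^ (l * k)          ≤⟨ *-monoˡ-≤ (n ^ (l * k)) (n≤1+n (suc a * suc b ^ k)) ⟩
    suc (suc a * suc b ^ k) * n ^ (l * k)    ∎ }
  where open ≤-Reasoning

-- Sizes of trees

1≤size : ∀ x → 1 ≤ size x
1≤size nil     = ≤-refl
1≤size (a ∙ b) = s≤s z≤n

-- The slack of one is for `nil`, whose head and tail are both `nil`.
size-head+tail : ∀ x → size (head x) + size (tail x) ≤ suc (size x)
size-head+tail nil     = ≤-refl
size-head+tail (a ∙ b) = m≤n⇒m≤1+n (n≤1+n _)

size-head : ∀ x → size (head x) ≤ size x
size-head nil     = ≤-refl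
size-head (a ∙ b) = m≤n⇒m≤1+n (m≤m+n (size a) (size b))

size-tail : ∀ x → size (tail x) ≤ size x
size-tail nil     = ≤-refl
size-tail (a ∙ b) = m≤n⇒m≤1+n (m≤n+m (size b) (size a))

-- Evaluation copies the input at most once for each variable occurrence in `e`, and every other
-- node adds at most one cell.
size-eval : ∀ (e : Exp 1) x → size (eval e (x ∷ [])) ≤ cost e * size x
size-eval (var zero)   x = ≤-reflexive (sym (*-identityˡ (size x)))
size-eval nil          x = ≤-trans (1≤size x) (≤-reflexive (sym (*-identityˡ (size x))))
size-eval (cons e₁ e₂) x = begin
  suc (size (eval e₁ (x ∷ [])) + size (eval e₂ (x ∷ [])))
    ≤⟨ +-mono-≤ (1≤size x) (+-mono-≤ (size-eval e₁ x) (size-eval e₂ x)) ⟩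
  size x + (cost e₁ * size x + cost e₂ * size x)
    ≡⟨ cong (size x +_) (*-distribʳ-+ (size x) (cost e₁) (cost e₂)) ⟨
  suc (cost e₁ + cost e₂) * size x ∎
  where open ≤-Reasoning
size-eval (hd e)       x = ≤-trans (size-head (eval e (x ∷ []))) (≤-trans (size-eval e x) (*-monoˡ-≤ (size x) (n≤1+n (cost e))))
size-eval (tl e)       x = ≤-trans (size-tail (eval e (x ∷ []))) (≤-trans (size-eval e x) (*-monoˡ-≤ (size x) (n≤1+n (cost e))))

-- One variable suffices, because a tree holds a whole tuple of values.

infix 4 _▷_↠_within_

_▷_↠_within_ : Command 1 → Tree → Tree → ℕ → Set
c ▷ x ↠ y within n = ∃[ t ] ⟨ c , x ∷ [] ⟩⇓⟨ y ∷ [] , t ⟩ × t ≤ n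

within-mono : ∀ {c x y m n} → m ≤ n → c ▷ x ↠ y within m → c ▷ x ↠ y within n
within-mono m≤n (t , run , t≤m) = t , run , ≤-trans t≤m m≤n

assign-within : ∀ e {x} → (zero := e) ▷ x ↠ eval e (x ∷ []) within suc (cost e)
assign-within e = _ , assign , ≤-refl

infixr 5 _then_

_then_ : ∀ {c d x y z m n} → c ▷ x ↠ y within m → d ▷ y ↠ z within n →
         (c ⨾ d) ▷ x ↠ z within (m + n)
(_ , run₁ , t₁≤) then (_ , run₂ , t₂≤) = _ , seq run₁ run₂ , +-mono-≤ t₁≤ t₂≤

-- Running a command beside a saved value

it : Exp 1
it = var zero

onTail : Exp 1 → Exp 1
onTail (var zero)   = tl it
onTail nil          = nil
onTail (cons e₁ e₂) = cons (onTail e₁) (onTail e₂)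
onTail (hd e)       = hd (onTail e)
onTail (tl e)       = tl (onTail e)

-- The command works on the tail of the tree while the head saves a value for later; this does the
-- work of further variables.
under : Command 1 → Command 1
under (zero := e)            = zero := cons (hd it) (onTail e)
under (c₁ ⨾ c₂)              = under c₁ ⨾ under c₂
under (if e then c₁ else c₂) = if onTail e then under c₁ else under c₂
under (while e repeat c)     = while onTail e repeat under c

framed : Tree → Store 1 → Store 1
framed a σ = (a ∙ lookup σ zero) ∷ []

eval-onTail : ∀ e a σ → eval (onTail e) (framed a σ) ≡ eval e σ
eval-onTail (var zero)   a σ = refl
eval-onTail nil          a σ = refl
eval-onTail (cons e₁ e₂) a σ rewrite eval-onTail e₁ a σ | eval-onTail e₂ a σ = refl
eval-onTail (hd e)       a σ rewrite eval-onTail e a σ = refl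
eval-onTail (tl e)       a σ rewrite eval-onTail e a σ = refl

cost-onTail : ∀ e → cost (onTail e) ≤ 2 * cost e
cost-onTail (var zero)   = ≤-refl
cost-onTail nil          = s≤s z≤n
cost-onTail (cons e₁ e₂) = begin
  suc (cost (onTail e₁) + cost (onTail e₂)) ≤⟨ s≤s (+-mono-≤ (cost-onTail e₁) (cost-onTail e₂)) ⟩
  suc (2 * cost e₁ + 2 * cost e₂)           ≡⟨ cong suc (*-distribˡ-+ 2 (cost e₁) (cost e₂)) ⟨
  suc (2 * (cost e₁ + cost e₂))             ≤⟨ n≤1+n _ ⟩
  2 + 2 * (cost e₁ + cost e₂)               ≡⟨ *-suc 2 (cost e₁ + cost e₂) ⟨
  2 * suc (cost e₁ + cost e₂)               ∎
  where open ≤-Reasoning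
cost-onTail (hd e)       = ≤-trans (s≤s (cost-onTail e)) (≤-trans (n≤1+n _) (≤-reflexive (sym (*-suc 2 (cost e)))))
cost-onTail (tl e)       = ≤-trans (s≤s (cost-onTail e)) (≤-trans (n≤1+n _) (≤-reflexive (sym (*-suc 2 (cost e)))))

-- Rebuilding the pair adds three steps and `onTail` at most doubles the cost of `e`. The factor 4
-- absorbs both, and it also covers tests.
assign-cost : ∀ e → suc (cost (cons (hd it) (onTail e))) ≤ 4 * suc (cost e)
assign-cost e = begin
  4 + cost (onTail e) ≤⟨ +-monoʳ-≤ 4 (cost-onTail e) ⟩
  4 + 2 * cost e      ≤⟨ +-monoʳ-≤ 4 (*-monoˡ-≤ (cost e) {2} {4} (s≤s (s≤s z≤n))) ⟩
  4 + 4 * cost e      ≡⟨ *-suc 4 (cost e) ⟨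
  4 * suc (cost e)    ∎
  where open ≤-Reasoning

test-cost : ∀ e → suc (cost (onTail e)) ≤ 4 * suc (cost e)
test-cost e = ≤-trans (m≤n+m (suc (cost (onTail e))) 3) (assign-cost e)

under-run : ∀ {c σ σ′ t} a → ⟨ c , σ ⟩⇓⟨ σ′ , t ⟩ →
            ∃[ t′ ] ⟨ under c , framed a σ ⟩⇓⟨ framed a σ′ , t′ ⟩ × t′ ≤ 4 * t
under-run {σ = x ∷ []} a (assign {e = e} {x = zero}) =
  _ , subst (λ y → ⟨ zero := cons (hd it) (onTail e) , (a ∙ x) ∷ [] ⟩⇓⟨ (a ∙ y) ∷ [] , suc (cost (cons (hd it) (onTail e))) ⟩)
            (eval-onTail e a (x ∷ [])) assign
    , assign-cost e
under-run a (seq {t₁ = t₁} {t₂ = t₂} r₁ r₂) with under-run a r₁ | under-run a r₂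
... | t₁′ , r₁′ , le₁ | t₂′ , r₂′ , le₂ = _ , seq r₁′ r₂′ ,
  ≤-trans (+-mono-≤ le₁ le₂) (≤-reflexive (sym (*-distribˡ-+ 4 t₁ t₂)))
under-run {σ = σ} a (if-true {e = e} {t = t} ≢nil r) with under-run a r
... | t′ , r′ , le = _ , if-true (subst (_≢ nil) (sym (eval-onTail e a σ)) ≢nil) r′ ,
  ≤-trans (+-mono-≤ (test-cost e) le) (≤-reflexive (sym (*-distribˡ-+ 4 (suc (cost e)) t)))
under-run {σ = σ} a (if-false {e = e} {t = t} ≡nil r) with under-run a r
... | t′ , r′ , le = _ , if-false (subst (_≡ nil) (sym (eval-onTail e a σ)) ≡nil) r′ ,
  ≤-trans (+-mono-≤ (test-cost e) le) (≤-reflexive (sym (*-distribˡ-+ 4 (suc (cost e)) t)))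
under-run {σ = σ} a (while-true {e = e} {t₁ = t₁} {t₂ = t₂} ≢nil r₁ r₂) with under-run a r₁ | under-run a r₂
... | t₁′ , r₁′ , le₁ | t₂′ , r₂′ , le₂ = _ ,
  while-true (subst (_≢ nil) (sym (eval-onTail e a σ)) ≢nil) r₁′ r₂′ ,
  (begin
    suc (cost (onTail e)) + (t₁′ + t₂′)      ≤⟨ +-mono-≤ (test-cost e) (+-mono-≤ le₁ le₂) ⟩
    4 * suc (cost e) + (4 * t₁ + 4 * t₂)     ≡⟨ cong (4 * suc (cost e) +_) (*-distribˡ-+ 4 t₁ t₂) ⟨
    4 * suc (cost e) + 4 * (t₁ + t₂)         ≡⟨ *-distribˡ-+ 4 (suc (cost e)) (t₁ + t₂) ⟨
    4 * (suc (cost e) + (t₁ + t₂))           ∎)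
  where open ≤-Reasoning
under-run {σ = σ} a (while-false {e = e} ≡nil) = _ ,
  while-false (subst (_≡ nil) (sym (eval-onTail e a σ)) ≡nil) , test-cost e

under-within : ∀ {c x y n} a → c ▷ x ↠ y within n → under c ▷ a ∙ x ↠ a ∙ y within 4 * n
under-within a (t , run , t≤n) with under-run a run
... | t′ , run′ , t′≤4t = t′ , run′ , ≤-trans t′≤4t (*-monoʳ-≤ 4 t≤n)

-- Procedures with bounds on time and output size

record Procedure : Set where
  field
    fn    : Tree → Tree
    code  : Command 1
    time  : Poly
    -- The output becomes the input of the next procedure, so its size has to be bounded too.
    width : Poly
    runs  : ∀ x → code ▷ x ↠ fn x within ⟦ time ⟧ (size x)
    fits  : ∀ x → size (fn x) ≤ ⟦ width ⟧ (size x)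

open Procedure

prim : Exp 1 → Procedure
prim e = record
  { fn    = λ x → eval e (x ∷ [])
  ; code  = zero := e
  ; time  = const (suc (cost e))
  ; width = const (cost e) ⊗ X
  ; runs  = λ x → assign-within e
  ; fits  = size-eval e
  }

infixl 5 _⨟_

_⨟_ : Procedure → Procedure → Procedure
p ⨟ q = record
  { fn    = λ x → fn q (fn p x)
  ; code  = code p ⨾ code q
  ; time  = time p ⊕ time q ⊙ width p
  ; width = width q ⊙ width p
  ; runs  = λ x → runs p x then within-mono (⟦⟧-mono (time q) (fits p x)) (runs q (fn p x))
  ; fits  = λ x → ≤-trans (fits q (fn p x)) (⟦⟧-mono (width q) (fits p x))
  }

infix 4 ⟪_,_⟫

-- The input is duplicated, `q` runs beside the saved copy, a swap brings that copy to the tail, `p`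
-- runs beside the result of `q`, and a second swap restores the order.
⟪_,_⟫ : Procedure → Procedure → Procedure
⟪ p , q ⟫ = record
  { fn    = λ x → fn p x ∙ fn q x
  ; code  = zero := cons it it ⨾ under (code q) ⨾
            zero := cons (tl it) (hd it) ⨾ under (code p) ⨾
            zero := cons (tl it) (hd it)
  ; time  = const 4 ⊕ (const 4 ⊗ time q ⊕ (const 6 ⊕ (const 4 ⊗ time p ⊕ const 6)))
  ; width = const 1 ⊕ (width p ⊕ width q)
  ; runs  = λ x → assign-within (cons it it) then
                  under-within x (runs q x) then
                  assign-within (cons (tl it) (hd it)) then
                  under-within (fn q x) (runs p x) then
                  assign-within (cons (tl it) (hd it))
  ; fits  = λ x → s≤s (+-mono-≤ (fits p x) (fits q x))
  }

select : Tree → Tree → Tree → Tree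
select nil     a b = b
select (_ ∙ _) a b = a

-- The times of both branches are added because `Poly` has no maximum.
select-within : ∀ {e c₁ c₂ x y₁ y₂ m n} →
                c₁ ▷ x ↠ y₁ within m → c₂ ▷ x ↠ y₂ within n →
                if e then c₁ else c₂ ▷ x ↠ select (eval e (x ∷ [])) y₁ y₂ within (suc (cost e) + (m + n))
select-within {e} {x = x} {m = m} {n} (t₁ , run₁ , t₁≤) (t₂ , run₂ , t₂≤) with eval e (x ∷ []) in eq
... | nil   = _ , if-false eq run₂ , +-monoʳ-≤ (suc (cost e)) (≤-trans t₂≤ (m≤n+m n m))
... | _ ∙ _ = _ , if-true (λ eq′ → case trans (sym eq) eq′ of λ ()) run₁ ,
              +-monoʳ-≤ (suc (cost e)) (≤-trans t₁≤ (m≤m+n m n))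

select-size : ∀ a {b c m n} → size b ≤ m → size c ≤ n → size (select a b c) ≤ m + n
select-size nil     {m = m} {n} b≤m c≤n = ≤-trans c≤n (m≤n+m n m)
select-size (_ ∙ _) {m = m} {n} b≤m c≤n = ≤-trans b≤m (m≤m+n m n)

cond : Procedure → Procedure → Procedure → Procedure
cond b p q = record
  { fn    = λ x → select (fn b x) (fn p x) (fn q x)
  ; code  = zero := cons it it ⨾ under (code b) ⨾
            if tl it then zero := hd it ⨾ code p else (zero := hd it ⨾ code q)
  ; time  = const 4 ⊕ (const 4 ⊗ time b ⊕ (const 3 ⊕ (const 3 ⊕ time p ⊕ (const 3 ⊕ time q))))
  ; width = width p ⊕ width q
  ; runs  = λ x → assign-within (cons it it) then
                  under-within x (runs b x) then
                  select-within {e = tl it}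
                    (assign-within (hd it) then runs p x)
                    (assign-within (hd it) then runs q x)
  ; fits  = λ x → select-size (fn b x) (fits p x) (fits q x)
  }

-- Unlike an ordinary left fold, the step sees the whole remaining list.
foldTree : (Tree → Tree) → Tree → Tree → Tree
foldTree f nil     s = s
foldTree f (a ∙ l) s = foldTree f l (f ((a ∙ l) ∙ s))

-- Growth per round is required to be additive, with an increment depending on the list only. A
-- bound such as `width step` could multiply the state in each round and would become exponential.
module _ (step : Procedure) (g : Poly)
         (growth : ∀ l s → size (fn step (l ∙ s)) ≤ size s + ⟦ g ⟧ (size l)) where

  private
    -- Turns `(a ∙ l) ∙ s` into `l ∙ (a ∙ l) ∙ s`: the rest of the list is saved in the head, and
    -- the tail is the input of the step.
    load : Exp 1
    load = cons (tl (hd it)) (cons (hd it) (tl it))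

    loop : Command 1
    loop = while hd it repeat (zero := load ⨾ under (code step))

    -- The loop test costs 3 and the assignment of `load` costs 10; the factor 4 is the overhead of
    -- `under`.
    round : ℕ → ℕ → ℕ
    round n M = 13 + 4 * ⟦ time step ⟧ (suc (n + M))

    -- A potential argument: passing one cell shrinks the list by at least one, which releases
    -- `⟦ g ⟧ n` and so pays for the growth of the state.
    budget : ∀ {n M} l s a → size (a ∙ l) ≤ n → size s + size (a ∙ l) * ⟦ g ⟧ n ≤ M →
             size (fn step ((a ∙ l) ∙ s)) + size l * ⟦ g ⟧ n ≤ M
    budget {n} {M} l s a l≤n s≤M = begin
      size (fn step ((a ∙ l) ∙ s)) + size l * ⟦ g ⟧ n          ≤⟨ +-monoˡ-≤ _ (growth (a ∙ l) s) ⟩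
      size s + ⟦ g ⟧ (size (a ∙ l)) + size l * ⟦ g ⟧ n         ≤⟨ +-monoˡ-≤ _ (+-monoʳ-≤ (size s) (⟦⟧-mono g l≤n)) ⟩
      size s + ⟦ g ⟧ n + size l * ⟦ g ⟧ n                      ≡⟨ +-assoc (size s) (⟦ g ⟧ n) _ ⟩
      size s + suc (size l) * ⟦ g ⟧ n                          ≤⟨ +-monoʳ-≤ (size s) (*-monoˡ-≤ (⟦ g ⟧ n) (s≤s (m≤n+m (size l) (size a)))) ⟩
      size s + size (a ∙ l) * ⟦ g ⟧ n                          ≤⟨ s≤M ⟩
      M                                                        ∎
      where open ≤-Reasoning

    loop-runs : ∀ {n M} l s → size l ≤ n → size s + size l * ⟦ g ⟧ n ≤ M →
                loop ▷ l ∙ s ↠ nil ∙ foldTree (fn step) l s within (size l * round n M + 3)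
    loop-runs {n} {M} nil s l≤n s≤M = _ , while-false refl , m≤n+m 3 (1 * round n M)
    loop-runs {n} {M} (a ∙ l) s l≤n s≤M
      with (assign-within load then under-within l (runs step ((a ∙ l) ∙ s)))
         | loop-runs {n} {M} l (fn step ((a ∙ l) ∙ s))
             (≤-trans (size-tail (a ∙ l)) l≤n) (budget l s a l≤n s≤M)
    ... | t₁ , run₁ , t₁≤ | t₂ , run₂ , t₂≤ = _ , while-true (λ ()) run₁ run₂ , (begin
      3 + (t₁ + t₂)                                      ≤⟨ +-monoʳ-≤ 3 (+-mono-≤ t₁≤ t₂≤) ⟩
      3 + (10 + 4 * ⟦ time step ⟧ (suc (size (a ∙ l) + size s)) + (size l * round n M + 3))
        ≤⟨ +-monoʳ-≤ 13 (+-monoˡ-≤ (size l * round n M + 3) (*-monoʳ-≤ 4 (⟦⟧-mono (time step)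
             (s≤s (+-mono-≤ l≤n (≤-trans (m≤m+n (size s) _) s≤M)))))) ⟩
      round n M + (size l * round n M + 3)               ≡⟨ +-assoc (round n M) _ 3 ⟨
      suc (size l) * round n M + 3                       ≤⟨ +-monoˡ-≤ 3 (*-monoˡ-≤ (round n M) (s≤s (m≤n+m (size l) (size a)))) ⟩
      size (a ∙ l) * round n M + 3                       ∎)
      where open ≤-Reasoning

    foldTree-fits : ∀ {n M} l s → size l ≤ n → size s + size l * ⟦ g ⟧ n ≤ M →
                    size (foldTree (fn step) l s) ≤ M
    foldTree-fits nil     s l≤n s≤M = ≤-trans (m≤m+n (size s) _) s≤M
    foldTree-fits (a ∙ l) s l≤n s≤M =
      foldTree-fits l (fn step ((a ∙ l) ∙ s)) (≤-trans (size-tail (a ∙ l)) l≤n) (budget l s a l≤n s≤M)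

    W : Poly
    W = X ⊕ X ⊗ g

    input-fits : ∀ x → size (tail x) + size (head x) * ⟦ g ⟧ (size x) ≤ ⟦ W ⟧ (size x)
    input-fits x = +-mono-≤ (size-tail x) (*-monoˡ-≤ _ (size-head x))

    fold-runs : ∀ x → loop ⨾ zero := tl it ▷ x ↠ foldTree (fn step) (head x) (tail x)
                      within (size x * round (size x) (⟦ W ⟧ (size x)) + 3 + 3)
    fold-runs nil     =
      (_ , while-false refl , m≤n+m 3 (1 * round 1 (⟦ W ⟧ 1))) then assign-within (tl it)
    fold-runs (l ∙ s) =
      within-mono (+-monoˡ-≤ 3 (*-monoˡ-≤ _ (size-head (l ∙ s)))) (loop-runs l s (size-head (l ∙ s)) (input-fits (l ∙ s)))
      then assign-within (tl it)

  fold : Procedure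
  fold = record
    { fn    = λ x → foldTree (fn step) (head x) (tail x)
    ; code  = loop ⨾ zero := tl it
    ; time  = X ⊗ (const 13 ⊕ const 4 ⊗ time step ⊙ (const 1 ⊕ (X ⊕ W))) ⊕ const 3 ⊕ const 3
    ; width = W
    ; runs  = fold-runs
    ; fits  = λ x → foldTree-fits (head x) (tail x) (size-head x) (input-fits x)
    }

-- Deciding hitting sets

truth : Tree → Bool
truth nil     = false
truth (_ ∙ _) = true

yes! no! : Procedure
yes! = prim (cons nil nil)
no!  = prim nil

neg : Procedure → Procedure
neg p = cond p no! yes!

both : Procedure → Procedure → Procedure
both p q = cond p q no!

module _ {P : Set} where

  neg-decides : ∀ {a} → Reflects P (truth a) → Reflects (¬ P) (truth (select a nil (nil ∙ nil)))
  neg-decides {nil}   r = ¬-reflects r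
  neg-decides {_ ∙ _} r = ¬-reflects r

module _ {P Q : Set} where

  both-decides : ∀ {a b} → Reflects P (truth a) → Reflects Q (truth b) →
                 Reflects (P × Q) (truth (select a b nil))
  both-decides {nil}   r s = r ×-reflects s
  both-decides {_ ∙ _} r s = r ×-reflects s

  map-reflects : ∀ {b} → (P → Q) → (Q → P) → Reflects P b → Reflects Q b
  map-reflects f g (ofʸ p)  = ofʸ (f p)
  map-reflects f g (ofⁿ ¬p) = ofⁿ (¬p ∘ g)

-- The predicate p is run on l ∙ c for the nonempty suffixes l of the given list,
-- where c is the context.  So in p, hd (hd it) is the current entry of the list
-- and tl it is the context; if the list is that of all points, tl (hd it) is the
-- index of the current point in unary.
module _ (p : Procedure) where

  someStep : Procedure
  -- The state is the context paired with the answer so far. The answer of `p` is normalised to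
  -- `nil ∙ nil` or `nil`, which keeps the growth constant.
  someStep = ⟪ prim (hd (tl it)) ,
    cond (prim (tl (tl it))) yes! (cond (prim (cons (hd it) (hd (tl it))) ⨟ p) yes! no!) ⟫

  some-growth : ∀ l s → size (fn someStep (l ∙ s)) ≤ size s + 9
  some-growth l s = begin
    suc (size (head s) + size answer) ≤⟨ s≤s (+-mono-≤ (size-head s) answer≤8) ⟩
    suc (size s + 8)                  ≡⟨ +-suc (size s) 8 ⟨
    size s + 9                        ∎
    where
    open ≤-Reasoning
    answer = select (tail s) (nil ∙ nil) (select (fn p (l ∙ head s)) (nil ∙ nil) nil)
    answer≤8 : size answer ≤ 8
    answer≤8 = ≤-trans
      (select-size (tail s) {b = nil ∙ nil} ≤-refl (select-size (fn p (l ∙ head s)) {b = nil ∙ nil} {c = nil} ≤-refl ≤-refl))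
      (n≤1+n 7)

  some : Procedure
  some = prim (cons (hd it) (cons (tl it) nil)) ⨟ fold someStep (const 9) some-growth ⨟ prim (tl it)

  private
    some-true : ∀ l c → tail (foldTree (fn someStep) l (c ∙ nil ∙ nil)) ≡ nil ∙ nil
    some-true nil     c = refl
    some-true (_ ∙ l) c = some-true l c

  some-∙ : ∀ a l c → truth (fn some ((a ∙ l) ∙ c)) ≡ truth (fn p ((a ∙ l) ∙ c)) ∨ truth (fn some (l ∙ c))
  some-∙ a l c with fn p ((a ∙ l) ∙ c)
  ... | nil   = refl
  ... | _ ∙ _ = cong truth (some-true l c)

  some-decides : ∀ {A : Set} {enc : A → Tree} {P : A → Set} c →
                 (∀ a l → Reflects (P a) (truth (fn p ((enc a ∙ l) ∙ c)))) →
                 ∀ xs → Reflects (Any P xs) (truth (fn some (encodeList enc xs ∙ c)))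
  some-decides c r []       = ofⁿ λ ()
  some-decides {enc = enc} c r (x ∷ xs) rewrite some-∙ (enc x) (encodeList enc xs) c =
    map-reflects (λ { (inj₁ px) → here px ; (inj₂ pxs) → there pxs })
                 (λ { (here px) → inj₁ px ; (there pxs) → inj₂ pxs })
                 (r x _ ⊎-reflects some-decides c r xs)

unary : ℕ → Tree
unary zero    = nil
unary (suc n) = nil ∙ unary n

-- Points carry no data in the encoding, so their list is a unary number. An arbitrary `f` in place
-- of the identity makes the induction go through.
encode-tabulate : ∀ {A : Set} (f : Fin n → A) → encodeList (λ _ → nil) (List.tabulate f) ≡ unary n
encode-tabulate {n = zero}  f = refl
encode-tabulate {n = suc n} f = cong (nil ∙_) (encode-tabulate (f ∘ suc))

-- The points are enumerated from the last one to the first, since a proper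
-- suffix of the list of all points stands for its own length.
somePoint-decides : ∀ p c {P : Fin n → Set} →
                    (∀ i → Reflects (P i) (truth (fn p ((nil ∙ unary (toℕ i)) ∙ c)))) →
                    Reflects (∃ P) (truth (fn (some p) (unary n ∙ c)))
somePoint-decides {n = n} p c {P} r = map-reflects
    (λ (i , _ , pi) → i , pi) (λ (i , pi) → i , toℕ<n i , pi)
    (go n ≤-refl)
  where
  go : ∀ m → m ≤ n → Reflects (∃[ i ] toℕ i < m × P i) (truth (fn (some p) (unary m ∙ c)))
  go zero    _   = ofⁿ λ ()
  go (suc m) m<n rewrite some-∙ p nil (unary m) c =
    map-reflects to from
      (subst (λ k → Reflects (P i₀) (truth (fn p ((nil ∙ unary k) ∙ c)))) (toℕ-fromℕ< m<n) (r i₀)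
        ⊎-reflects go m (<⇒≤ m<n))
    where
    i₀ : Fin n
    i₀ = fromℕ< m<n

    to : P i₀ ⊎ (∃[ i ] toℕ i < m × P i) → ∃[ i ] toℕ i < suc m × P i
    to (inj₁ pi₀)            = i₀ , s≤s (≤-reflexive (toℕ-fromℕ< m<n)) , pi₀
    to (inj₂ (i , i<m , pi)) = i , m<n⇒m<1+n i<m , pi

    from : (∃[ i ] toℕ i < suc m × P i) → P i₀ ⊎ (∃[ i ] toℕ i < m × P i)
    from (i , i≤m , pi) with m<1+n⇒m<n∨m≡n i≤m
    ... | inj₁ i<m = inj₂ (i , i<m , pi)
    ... | inj₂ i≡m = inj₁ (subst P (toℕ-injective (trans i≡m (sym (toℕ-fromℕ< m<n)))) pi)

-- Tests on points and sets

row : Subset n → Tree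
row A = encodeList encodeBool (toList A)

-- The fold runs over the unary index with the row as its state. Each round drops one bit, which
-- leaves the wanted bit at the head.
member : Procedure
member = fold (prim (tl (tl it))) (const 0)
              (λ l s → ≤-trans (size-tail s) (m≤m+n (size s) 0)) ⨟ prim (hd it)

member-decides : ∀ (i : Fin n) A → Reflects (i ∈ˢ A) (truth (fn member (unary (toℕ i) ∙ row A)))
member-decides zero    (true  ∷ A) = ofʸ here
member-decides zero    (false ∷ A) = ofⁿ λ ()
member-decides (suc i) (b ∷ A)     = map-reflects there drop-there (member-decides i A)

mem : Exp 1 → Exp 1 → Procedure
mem i A = prim (cons i A) ⨟ member

common : Procedure
common = both (mem (tl (hd it)) (hd (tl it))) (mem (tl (hd it)) (tl (tl it)))

meets : Procedure
meets = some common

meets-decides : ∀ (A B : Subset n) → Reflects (Nonempty (A ∩ B)) (truth (fn meets (unary n ∙ row A ∙ row B)))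
meets-decides A B = map-reflects
  (λ (i , i∈) → i , x∈p∩q⁺ i∈) (λ (i , i∈) → i , x∈p∩q⁻ A B i∈)
  (somePoint-decides common (row A ∙ row B) (λ i → both-decides (member-decides i A) (member-decides i B)))

extra : Procedure
extra = both (mem (tl (hd it)) (hd (tl it))) (neg (mem (tl (hd it)) (tl (tl it))))

outside : Procedure
outside = some extra

outside-decides : ∀ (A B : Subset n) →
                  Reflects (∃[ i ] i ∈ˢ A × i ∉ˢ B) (truth (fn outside (unary n ∙ row A ∙ row B)))
outside-decides A B =
  somePoint-decides extra (row A ∙ row B) (λ i → both-decides (member-decides i A) (neg-decides (member-decides i B)))

proper : Procedure
proper = both (neg outside) (prim (cons (hd it) (cons (tl (tl it)) (hd (tl it)))) ⨟ outside)

proper-decides : ∀ (A B : Subset n) → Reflects (A ⊂ B) (truth (fn proper (unary n ∙ row A ∙ row B)))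
proper-decides A B = map-reflects
  (λ (¬out , out) → (λ {x} x∈A → decidable-stable (x ∈? B) λ x∉B → ¬out (x , x∈A , x∉B)) , out)
  (λ (A⊆B , out) → (λ (x , x∈A , x∉B) → x∉B (A⊆B x∈A)) , out)
  (both-decides (neg-decides (outside-decides A B)) (outside-decides B A))

-- Tests on collections of sets

rows : List (Subset n) → Tree
rows = encodeList row

Minimal : List (Subset n) → Subset n → Set
Minimal L A = ¬ Any (_⊂ A) L

smaller : Procedure
smaller = prim (cons (tl (tl it)) (cons (hd (hd it)) (hd (tl it)))) ⨟ proper

minimal : Procedure
minimal = neg (some smaller)

minimal-decides : ∀ L (A : Subset n) → Reflects (Minimal L A) (truth (fn minimal (rows L ∙ row A ∙ unary n)))
minimal-decides {n} L A =
  neg-decides (some-decides smaller (row A ∙ unary n) (λ B _ → proper-decides B A) L)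

-- A set is empty if and only if it does not meet itself, so `meets` can be reused.
empty : Procedure
empty = neg (prim (cons (tl it) (cons (hd (hd it)) (hd (hd it)))) ⨟ meets)

hasEmpty : Procedure
hasEmpty = some empty

hasEmpty-decides : ∀ (L : List (Subset n)) →
                   Reflects (Any (λ A → ¬ Nonempty (A ∩ A)) L) (truth (fn hasEmpty (rows L ∙ unary n)))
hasEmpty-decides {n} L = some-decides empty (unary n) (λ A _ → neg-decides (meets-decides A A)) L

-- The points may coincide, and the diagonal expresses that a single point hits every set.
PairHits : List (Subset n) → Fin n → Fin n → Set
PairHits L x y = ∀ A → A ∈ L → x ∈ˢ A ⊎ y ∈ˢ A

missed : Procedure
missed = both (neg (mem (hd (tl it)) (hd (hd it)))) (neg (mem (tl (tl it)) (hd (hd it))))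

pairHits : Procedure
pairHits = neg (some missed)

pairHits-decides : ∀ L (x y : Fin n) →
                   Reflects (PairHits L x y) (truth (fn pairHits (rows L ∙ unary (toℕ x) ∙ unary (toℕ y))))
pairHits-decides L x y = map-reflects to from
  (neg-decides (some-decides missed (unary (toℕ x) ∙ unary (toℕ y))
    (λ A _ → both-decides (neg-decides (member-decides x A)) (neg-decides (member-decides y A))) L))
  where
  Missed = λ A → x ∉ˢ A × y ∉ˢ A

  to : ¬ Any Missed L → PairHits L x y
  to ¬any A A∈L with x ∈? A | y ∈? A
  ... | yes x∈A | _       = inj₁ x∈A
  ... | no  _   | yes y∈A = inj₂ y∈A
  ... | no  x∉A | no  y∉A = contradiction (lose A∈L (x∉A , y∉A)) ¬any

  from : PairHits L x y → ¬ Any Missed L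
  from hits any with find any
  ... | A , A∈L , x∉A , y∉A with hits A A∈L
  ...   | inj₁ x∈A = x∉A x∈A
  ...   | inj₂ y∈A = y∉A y∈A

pointHits : Procedure
pointHits = prim (cons (tl it) (cons (tl (hd it)) (tl (hd it)))) ⨟ pairHits

hittingPoint : Procedure
hittingPoint = some pointHits

hittingPoint-decides : ∀ (L : List (Subset n)) →
                       Reflects (∃[ x ] PairHits L x x) (truth (fn hittingPoint (unary n ∙ rows L)))
hittingPoint-decides L = somePoint-decides pointHits (rows L) (λ x → pairHits-decides L x x)

partnerHits : Procedure
partnerHits = prim (cons (tl (tl it)) (cons (hd (tl it)) (tl (hd it)))) ⨟ pairHits

hasPartner : Procedure
hasPartner = prim (cons (hd (tl it)) (cons (tl (hd it)) (tl (tl it)))) ⨟ some partnerHits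

-- The list of points is copied into the context, since the inner search needs all of it while the
-- outer one consumes its own copy.
hittingPair : Procedure
hittingPair = prim (cons (hd it) it) ⨟ some hasPartner

hittingPair-decides : ∀ (L : List (Subset n)) →
                      Reflects (∃[ x ] ∃[ y ] PairHits L x y) (truth (fn hittingPair (unary n ∙ rows L)))
hittingPair-decides {n} L = somePoint-decides hasPartner (unary n ∙ rows L) (λ x →
  somePoint-decides partnerHits (unary (toℕ x) ∙ rows L) (λ y → pairHits-decides L x y))

-- The greedy packing

meetsMember : Procedure
meetsMember = prim (cons (tl (tl it)) (cons (hd (tl it)) (hd (hd it)))) ⨟ meets

someMeets : Procedure
someMeets = some meetsMember

someMeets-decides : ∀ (P : List (Subset n)) A →
                    Reflects (Any (λ B → Nonempty (A ∩ B)) P) (truth (fn someMeets (rows P ∙ row A ∙ unary n)))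
someMeets-decides {n} P A = some-decides meetsMember (row A ∙ unary n) (λ B _ → meets-decides A B) P

-- The whole collection travels in the context, because minimality is judged against it and not
-- against the suffix still to be read.
addable : Procedure
addable = both
  (prim (cons (tl (hd (tl it))) (cons (hd (hd it)) (hd (hd (tl it))))) ⨟ minimal)
  (neg (prim (cons (tl (tl it)) (cons (hd (hd it)) (hd (hd (tl it))))) ⨟ someMeets))

packStep : Procedure
packStep = ⟪ prim (hd (tl it)) ,
  cond addable (prim (cons (hd (hd it)) (tl (tl it)))) (prim (tl (tl it))) ⟫

-- The row that is added is the head of `l`, so the growth is linear in the list.
packStep-growth : ∀ l s → size (fn packStep (l ∙ s)) ≤ size s + ⟦ const 3 ⊕ X ⟧ (size l)
packStep-growth l s = begin
  suc (size (head s) + size (select (fn addable (l ∙ s)) (head (head (l ∙ s)) ∙ tail s) (tail s)))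
    ≤⟨ s≤s (+-monoʳ-≤ (size (head s)) (lemma (fn addable (l ∙ s)))) ⟩
  suc (size (head s) + (size (tail s) + suc (size l)))
    ≡⟨ cong suc (+-assoc (size (head s)) (size (tail s)) _) ⟨
  suc (size (head s) + size (tail s) + suc (size l))
    ≤⟨ s≤s (+-monoˡ-≤ (suc (size l)) (size-head+tail s)) ⟩
  suc (suc (size s) + suc (size l))
    ≡⟨ trans (+-suc (size s) (2 + size l)) (cong suc (+-suc (size s) (1 + size l))) ⟨
  size s + (3 + size l) ∎
  where
  open ≤-Reasoning
  lemma : ∀ b → size (select b (head l ∙ tail s) (tail s)) ≤ size (tail s) + suc (size l)
  lemma nil     = m≤m+n (size (tail s)) _
  lemma (_ ∙ _) = ≤-trans (s≤s (+-monoˡ-≤ (size (tail s)) (size-head l))) (≤-reflexive (+-comm (suc (size l)) (size (tail s))))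

packing : Procedure
packing = prim (cons (tl it) (cons it nil)) ⨟ fold packStep (const 3 ⊕ X) packStep-growth ⨟ prim (tl it)

Disjoint : Subset n → Subset n → Set
Disjoint A B = ¬ Nonempty (A ∩ B)

record Packing (L P : List (Subset n)) : Set where
  field
    ⊆sets    : All (_∈ L) P
    minimals : All (Minimal L) P
    disjoint : AllPairs Disjoint P

open Packing

-- The last clause is maximality. A minimal set that is rejected meets a member already chosen, and
-- members are never removed; one that is accepted meets itself, being nonempty.
packing-computes : ∀ (L : List (Subset n)) →
  (∀ A → A ∈ L → Nonempty (A ∩ A)) →
  ∃[ P ] fn packing (unary n ∙ rows L) ≡ rows P × Packing L P ×
         (∀ A → A ∈ L → Minimal L A → Any (λ B → Nonempty (A ∩ B)) P)
packing-computes {n} L nonempty with go L [] (λ A A∈ → A∈) (record { ⊆sets = [] ; minimals = [] ; disjoint = [] })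
  where
  ctx : Tree
  ctx = unary n ∙ rows L

  go : ∀ M Q → (∀ A → A ∈ M → A ∈ L) → Packing L Q →
       ∃[ P ] foldTree (fn packStep) (rows M) (ctx ∙ rows Q) ≡ ctx ∙ rows P × Packing L P ×
              (∀ {A} → Any (λ B → Nonempty (A ∩ B)) Q → Any (λ B → Nonempty (A ∩ B)) P) ×
              (∀ A → A ∈ M → Minimal L A → Any (λ B → Nonempty (A ∩ B)) P)
  go []      Q M⊆L packQ = Q , refl , packQ , (λ meet → meet) , λ _ ()
  go (A ∷ M) Q M⊆L packQ
    with fn addable ((row A ∙ rows M) ∙ ctx ∙ rows Q)
       | both-decides (minimal-decides L A) (neg-decides (someMeets-decides Q A))
  ... | nil   | ofⁿ ¬add with go M Q (λ B → M⊆L B ∘ there) packQ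
  ...   | P , eq , packP , keep , meet = P , eq , packP , keep , λ where
            _ (here refl) min → keep (decidable-stable (any? (λ B → nonempty? (A ∩ B)) Q) (λ ¬meets → ¬add (min , ¬meets)))
            B (there B∈M) min → meet B B∈M min
  go (A ∷ M) Q M⊆L packQ | _ ∙ _ | ofʸ (min , ¬meets) with go M (A ∷ Q) (λ B → M⊆L B ∘ there) (record
       { ⊆sets    = M⊆L A (here refl) ∷ ⊆sets packQ
       ; minimals = min ∷ minimals packQ
       ; disjoint = ¬Any⇒All¬ Q ¬meets ∷ disjoint packQ
       })
  ...   | P , eq , packP , keep , meet = P , eq , packP , keep ∘ there , λ where
            _ (here refl) _   → keep (here (nonempty A (M⊆L A (here refl))))
            B (there B∈M) min → meet B B∈M min
... | P , eq , packP , _ , meet = P , cong tail eq , packP , meet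

-- Halving and comparison with a binary number

halfStep : Procedure
halfStep = cond (prim (hd (tl it)))
  (prim (cons (tl (tl (hd (tl it)))) (tl (tl (tl it)))))
  (prim (tl it))

halfStep-growth : ∀ l s → size (fn halfStep (l ∙ s)) ≤ size s + 0
halfStep-growth l nil             = ≤-refl
halfStep-growth l (nil ∙ w)       = m≤m+n _ 0
halfStep-growth l ((a ∙ f) ∙ w)   = m≤n⇒m≤n+o 0
  (s≤s (+-mono-≤ (≤-trans (size-tail f) (size-tail (a ∙ f))) (size-tail w)))

-- Drops one cell for every two cells passed by a pointer running ahead.
half : Procedure
half = prim (cons it (cons it it)) ⨟ fold halfStep (const 0) halfStep-growth ⨟ prim (tl it)

cells : Tree → ℕ
cells nil     = 0
cells (_ ∙ l) = suc (cells l)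

cells-tail : ∀ x → cells (tail x) ≡ cells x ∸ 1
cells-tail nil     = refl
cells-tail (_ ∙ _) = refl

-- With m cells the leading pointer moves ⌈m/2⌉ times, stepping past the end if m is odd, and m
-- minus ⌈m/2⌉ is ⌊m/2⌋.
cells-half : ∀ x → cells (fn half x) ≡ ⌊ cells x /2⌋
cells-half x = trans (go x x x (⌈n/2⌉≤n (cells x)))
  (trans (cong (_∸ ⌈ cells x /2⌉) (sym (⌊n/2⌋+⌈n/2⌉≡n (cells x)))) (m+n∸n≡m _ ⌈ cells x /2⌉))
  where
  go : ∀ l f w → ⌈ cells f /2⌉ ≤ cells l →
       cells (tail (foldTree (fn halfStep) l (f ∙ w))) ≡ cells w ∸ ⌈ cells f /2⌉
  go nil     nil           w _   = refl
  go nil     (_ ∙ nil)     w ()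
  go nil     (_ ∙ _ ∙ f)   w ()
  go (_ ∙ l) nil           w _   = go l nil w z≤n
  go (_ ∙ l) (_ ∙ nil)     w _   = trans (go l nil (tail w) z≤n) (cells-tail w)
  go (_ ∙ l) (_ ∙ _ ∙ f)   w (s≤s f≤l) = trans (go l f (tail w) f≤l)
    (trans (cong (_∸ ⌈ cells f /2⌉) (cells-tail w)) (∸-+-assoc (cells w) 1 ⌈ cells f /2⌉))

-- The general bound `fits` carries a constant factor, which would compound when `bitStep` is folded
-- over the digits.
size-half : ∀ x → size (fn half x) ≤ size x
size-half x = go x (x ∙ x)
  where
  step-tail : ∀ l s → size (tail (fn halfStep (l ∙ s))) ≤ size (tail s)
  step-tail l nil           = ≤-refl
  step-tail l (nil ∙ w)     = ≤-refl
  step-tail l ((_ ∙ _) ∙ w) = size-tail w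

  go : ∀ l s → size (tail (foldTree (fn halfStep) l s)) ≤ size (tail s)
  go nil     s = ≤-refl
  go (a ∙ l) s = ≤-trans (go l (fn halfStep ((a ∙ l) ∙ s))) (step-tail (a ∙ l) s)

⌊m/2⌋≤n⇒m≤1+2n : ∀ m n → ⌊ m /2⌋ ≤ n → m ≤ suc (2 * n)
⌊m/2⌋≤n⇒m≤1+2n zero          n       _       = z≤n
⌊m/2⌋≤n⇒m≤1+2n (suc zero)    n       _       = s≤s z≤n
⌊m/2⌋≤n⇒m≤1+2n (suc (suc m)) (suc n) (s≤s p) = s≤s
  (≤-trans (s≤s (⌊m/2⌋≤n⇒m≤1+2n m n p)) (≤-reflexive (sym (*-suc 2 n))))

m≤1+2n⇒⌊m/2⌋≤n : ∀ m n → m ≤ suc (2 * n) → ⌊ m /2⌋ ≤ n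
m≤1+2n⇒⌊m/2⌋≤n zero          n       _       = z≤n
m≤1+2n⇒⌊m/2⌋≤n (suc zero)    n       _       = z≤n
m≤1+2n⇒⌊m/2⌋≤n (suc (suc m)) zero    (s≤s ())
m≤1+2n⇒⌊m/2⌋≤n (suc (suc m)) (suc n) (s≤s p) = s≤s
  (m≤1+2n⇒⌊m/2⌋≤n m n (s≤s⁻¹ (≤-trans p (≤-reflexive (*-suc 2 n)))))

-- Processing one digit of the bound rests on c ≤ 2(1 + b) ⇔ ⌊(c ∸ 1) / 2⌋ ≤ b
-- and c ≤ 1 + 2b ⇔ ⌊c / 2⌋ ≤ b.
bitStep : Procedure
bitStep = cond (prim (hd (hd it))) (prim (tl it)) (prim (tl (tl it))) ⨟ half

bitStep-growth : ∀ l s → size (fn bitStep (l ∙ s)) ≤ size s + 0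
bitStep-growth l s = m≤n⇒m≤n+o 0 (≤-trans (size-half _) (lemma (head l)))
  where
  lemma : ∀ b → size (select b s (tail s)) ≤ size s
  lemma nil     = size-tail s
  lemma (_ ∙ _) = ≤-refl

-- Digits come least significant first, and the list is halved along with the bound. The bound is
-- never written in unary, which could take exponential time. When the digits run out, the
-- comparison is with 0, so it holds exactly when nothing is left of the list.
atMost : Procedure
atMost = neg (fold bitStep (const 0) bitStep-growth)

atMost-decides : ∀ k c → Reflects (cells c ≤ k) (truth (fn atMost (encodeℕ k ∙ c)))
atMost-decides k c = subst (λ m → Reflects (cells c ≤ m) (truth (fn atMost (encodeℕ k ∙ c)))) (ℕᵇ.toℕ-fromℕ k) (go (ℕᵇ.fromℕ k) c)
  where
  odd⁺ : ∀ b c → cells (fn half c) ≤ ℕᵇ.toℕ b → cells c ≤ suc (2 * ℕᵇ.toℕ b)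
  odd⁺ b c p = ⌊m/2⌋≤n⇒m≤1+2n (cells c) (ℕᵇ.toℕ b) (≤-trans (≤-reflexive (sym (cells-half c))) p)

  odd⁻ : ∀ b c → cells c ≤ suc (2 * ℕᵇ.toℕ b) → cells (fn half c) ≤ ℕᵇ.toℕ b
  odd⁻ b c p = ≤-trans (≤-reflexive (cells-half c)) (m≤1+2n⇒⌊m/2⌋≤n (cells c) (ℕᵇ.toℕ b) p)

  go : ∀ b c → Reflects (cells c ≤ ℕᵇ.toℕ b) (truth (fn atMost (encodeℕᵇ b ∙ c)))
  go ℕᵇ.zero  nil     = ofʸ z≤n
  go ℕᵇ.zero  (_ ∙ _) = ofⁿ λ ()
  go 2[1+ b ] nil     = map-reflects (λ _ → z≤n) (λ _ → z≤n) (go b nil)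
  go 2[1+ b ] (_ ∙ c) = map-reflects
    (λ p → ≤-trans (s≤s (odd⁺ b c p)) (≤-reflexive (sym (*-suc 2 (ℕᵇ.toℕ b)))))
    (λ p → odd⁻ b c (s≤s⁻¹ (≤-trans p (≤-reflexive (*-suc 2 (ℕᵇ.toℕ b))))))
    (go b (fn half c))
  go 1+[2 b ] c       = map-reflects (odd⁺ b c) (odd⁻ b c) (go b (fn half c))

-- The decision algorithm

solve : Procedure
solve =
  cond (prim (cons (tl (hd it)) (hd (hd it))) ⨟ hasEmpty) no!
    (cond (prim (hd it) ⨟ hittingPoint) yes!
      (cond (prim (hd it) ⨟ hittingPair)
        -- The constant is a list of two cells: without a hitting point but with a hitting pair, the
        -- minimum is 2.
        (prim (cons (tl it) (cons nil (cons nil nil))) ⨟ atMost)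
        (⟪ prim (tl it) , prim (hd it) ⨟ packing ⟫ ⨟ atMost)))

-- Minimal sets and packings

module _ {A : Set} {_≼_ : A → A → Set} (≼-trans : Transitive _≼_) (_≼?_ : Decidable _≼_) where

  -- The membership of `x` excludes the empty list. The conclusion is `z ≼ m` and not an equation,
  -- since distinct points can lie in the same sets.
  maximal : ∀ {x} xs → x ∈ xs → ∃[ m ] m ∈ xs × (∀ {z} → z ∈ xs → m ≼ z → z ≼ m)
  maximal (x ∷ [])     _ = x , here refl , λ { (here refl) m≼z → m≼z }
  maximal (x ∷ y ∷ xs) _ with maximal (y ∷ xs) (here refl)
  ... | m , m∈ , max with m ≼? x
  ...   | yes m≼x = x , here refl , λ { (here refl) x≼z → x≼z
                                      ; (there z∈) x≼z → ≼-trans (max z∈ (≼-trans m≼x x≼z)) m≼x }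
  ...   | no  m⋠x = m , there m∈ , λ { (here refl) m≼x → contradiction m≼x m⋠x
                                     ; (there z∈) → max z∈ }

-- A maximal element for reversed inclusion among the members of `L` inside `A`; whatever lies below
-- it is again inside `A`.
minimal-below : ∀ {L : List (Subset n)} {A} → A ∈ L → ∃[ B ] B ∈ L × Minimal L B × B ⊆ A
minimal-below {L = L} {A} A∈L
  with maximal {_≼_ = λ B C → C ⊆ B} (λ C⊆B D⊆C x∈ → C⊆B (D⊆C x∈)) (λ B C → C ⊆? B)
               (filter (_⊆? A) L) (∈-filter⁺ (_⊆? A) A∈L (λ x∈ → x∈))
... | B , B∈ , max with ∈-filter⁻ (_⊆? A) {xs = L} B∈
...   | B∈L , B⊆A = B , B∈L , min , B⊆A
  where
  min : Minimal L B
  min smaller with find smaller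
  ... | C , C∈L , C⊆B , x , x∈B , x∉C =
    x∉C (max (∈-filter⁺ (_⊆? A) C∈L (λ y∈C → B⊆A (C⊆B y∈C))) C⊆B x∈B)

minimal-⊈ : ∀ {L : List (Subset n)} {A B} → B ∈ L → Minimal L A → A ≢ B → ∃[ x ] x ∈ˢ B × x ∉ˢ A
minimal-⊈ {A = A} {B} B∈L minA A≢B with Fin.any? (λ x → (x ∈? B) ×-dec ¬? (x ∈? A))
... | yes out = out
... | no ¬out = contradiction (lose B∈L ((λ {z} → B⊆A {z}) , decidable-stable (Fin.any? (λ x → (x ∈? A) ×-dec ¬? (x ∈? B)))
        (λ ¬out′ → A≢B (⊆-antisym (⊆-from ¬out′) B⊆A)))) minA
  where
  ⊆-from : ∀ {C D : Subset _} → ¬ (∃[ x ] x ∈ˢ C × x ∉ˢ D) → C ⊆ D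
  ⊆-from {D = D} ¬out {x} x∈C = decidable-stable (x ∈? D) (λ x∉D → ¬out (x , x∈C , x∉D))
  B⊆A : B ⊆ A
  B⊆A = ⊆-from ¬out

-- The only consequence of either dimension hypothesis on which the correctness of the algorithm
-- rests.
Anchored : List (Subset n) → Set
Anchored L = ∀ A → A ∈ L → Minimal L A →
             ∃[ y ] ∀ R → R ∈ L → Minimal L R → Nonempty (R ∩ A) → y ∈ˢ R

∣p∪q∣≤∣p∣+∣q∣ : ∀ (p q : Subset n) → ∣ p ∪ q ∣ ≤ ∣ p ∣ + ∣ q ∣
∣p∪q∣≤∣p∣+∣q∣ []          []          = z≤n
∣p∪q∣≤∣p∣+∣q∣ (true  ∷ p) (b     ∷ q) = s≤s (≤-trans (∣p∪q∣≤∣p∣+∣q∣ p q) (+-monoʳ-≤ ∣ p ∣ (∣p∣≤∣x∷p∣ b q)))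
∣p∪q∣≤∣p∣+∣q∣ (false ∷ p) (true  ∷ q) = ≤-trans (s≤s (∣p∪q∣≤∣p∣+∣q∣ p q)) (≤-reflexive (sym (+-suc ∣ p ∣ ∣ q ∣)))
∣p∪q∣≤∣p∣+∣q∣ (false ∷ p) (false ∷ q) = ∣p∪q∣≤∣p∣+∣q∣ p q

-- `H` collects one anchor for each member of `P`.
anchors-hit : ∀ {L : List (Subset n)} → Anchored L → ∀ P → All (_∈ L) P → All (Minimal L) P →
              ∃[ H ] ∣ H ∣ ≤ length P ×
                     (∀ R → R ∈ L → Minimal L R → Any (λ A → Nonempty (R ∩ A)) P → Nonempty (H ∩ R))
anchors-hit {n} anchored []      _            _             = ∅ , ≤-reflexive (∣⊥∣≡0 n) , λ _ _ _ ()
anchors-hit {n} anchored (A ∷ P) (A∈L ∷ P⊆L) (minA ∷ minP)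
  with anchored A A∈L minA | anchors-hit anchored P P⊆L minP
... | y , y∈ | H , ∣H∣≤ , hits =
    ⁅ y ⁆ ∪ H
  , ≤-trans (∣p∪q∣≤∣p∣+∣q∣ ⁅ y ⁆ H) (+-mono-≤ (≤-reflexive (∣⁅x⁆∣≡1 y)) ∣H∣≤)
  , λ where
      R R∈L minR (here meet) → y , x∈p∩q⁺ (x∈p∪q⁺ (inj₁ (x∈⁅x⁆ y)) , y∈ R R∈L minR meet)
      R R∈L minR (there meet) → let z , z∈ = hits R R∈L minR meet
                                    z∈H , z∈R = x∈p∩q⁻ H R z∈
                                in z , x∈p∩q⁺ (x∈p∪q⁺ (inj₂ z∈H) , z∈R)

-- Removing from `H` a point of the first set leaves the other sets hit, as they are disjoint from
-- it. So every set uses up a point of its own.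
packing≤hitting : ∀ {P} {H : Subset n} → AllPairs Disjoint P → All (λ A → Nonempty (H ∩ A)) P → length P ≤ ∣ H ∣
packing≤hitting []              []              = z≤n
packing≤hitting {P = A ∷ P} {H} (disj ∷ disjs) ((x , x∈) ∷ hits) =
  ≤-trans (s≤s (packing≤hitting disjs (All.zipWith still (disj , hits)))) (x∈p⇒∣p-x∣<∣p∣ x∈H)
  where
  x∈H : x ∈ˢ H
  x∈H = proj₁ (x∈p∩q⁻ H A x∈)

  still : ∀ {B} → Disjoint A B × Nonempty (H ∩ B) → Nonempty ((H - x) ∩ B)
  still {B} (disj , y , y∈) with x∈p∩q⁻ H B y∈
  ... | y∈H , y∈B = y , x∈p∩q⁺ (x∈p∧x≢y⇒x∈p-y y∈H y≢x , y∈B)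
    where
    y≢x : y ≢ x
    y≢x refl = disj (y , x∈p∩q⁺ (proj₂ (x∈p∩q⁻ H A x∈) , y∈B))

2≤∣p∣ : ∀ {p : Subset n} {x y} → x ∈ˢ p → y ∈ˢ p → y ≢ x → 2 ≤ ∣ p ∣
2≤∣p∣ x∈p y∈p y≢x =
  ≤-trans (s≤s (≤-trans (s≤s z≤n) (x∈p⇒∣p-x∣<∣p∣ (x∈p∧x≢y⇒x∈p-y y∈p y≢x)))) (x∈p⇒∣p-x∣<∣p∣ x∈p)

-- Anchors in VC-dimension 1

module _ {G : SetSystem} (vc : HasVCDimension G 1) {x y : Fin (points G)} (y≢x : y ≢ x) where

  -- Together the four patterns would shatter a set of two points.
  not-all-patterns : (∃[ R ] R ∈ sets G × x ∈ˢ R × y ∈ˢ R) → (∃[ R ] R ∈ sets G × x ∈ˢ R × y ∉ˢ R) →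
                     (∃[ R ] R ∈ sets G × x ∉ˢ R × y ∈ˢ R) → (∃[ R ] R ∈ sets G × x ∉ˢ R × y ∉ˢ R) → ⊥
  not-all-patterns (R₁₁ , R₁₁∈ , x₁₁ , y₁₁) (R₁₀ , R₁₀∈ , x₁₀ , y₁₀) (R₀₁ , R₀₁∈ , x₀₁ , y₀₁) (R₀₀ , R₀₀∈ , x₀₀ , y₀₀) =
    <⇒≱ (2≤∣p∣ x∈A y∈A y≢x) (proj₂ vc A λ B → mk⇔ (λ { (R , _ , refl) → p∩q⊆q R A }) (trace B))
    where
    A : Subset (points G)
    A = ⁅ x ⁆ ∪ ⁅ y ⁆

    x∈A : x ∈ˢ A
    x∈A = x∈p∪q⁺ (inj₁ (x∈⁅x⁆ x))

    y∈A : y ∈ˢ A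
    y∈A = x∈p∪q⁺ (inj₂ (x∈⁅x⁆ y))

    agree : ∀ {B R} → B ⊆ A → (x ∈ˢ B → x ∈ˢ R) → (x ∈ˢ R → x ∈ˢ B) → (y ∈ˢ B → y ∈ˢ R) → (y ∈ˢ R → y ∈ˢ B) → B ≡ R ∩ A
    agree {B} {R} B⊆A x→ x← y→ y← = ⊆-antisym
      (λ z∈B → x∈p∩q⁺ (to z∈B (x∈p∪q⁻ ⁅ x ⁆ ⁅ y ⁆ (B⊆A z∈B)) , B⊆A z∈B))
      (λ z∈ → let z∈R , z∈A = x∈p∩q⁻ R A z∈ in from z∈R (x∈p∪q⁻ ⁅ x ⁆ ⁅ y ⁆ z∈A))
      where
      to : ∀ {z} → z ∈ˢ B → z ∈ˢ ⁅ x ⁆ ⊎ z ∈ˢ ⁅ y ⁆ → z ∈ˢ R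
      to z∈B (inj₁ z∈x) with refl ← x∈⁅y⁆⇒x≡y x z∈x = x→ z∈B
      to z∈B (inj₂ z∈y) with refl ← x∈⁅y⁆⇒x≡y y z∈y = y→ z∈B

      from : ∀ {z} → z ∈ˢ R → z ∈ˢ ⁅ x ⁆ ⊎ z ∈ˢ ⁅ y ⁆ → z ∈ˢ B
      from z∈R (inj₁ z∈x) with refl ← x∈⁅y⁆⇒x≡y x z∈x = x← z∈R
      from z∈R (inj₂ z∈y) with refl ← x∈⁅y⁆⇒x≡y y z∈y = y← z∈R

    trace : ∀ B → B ⊆ A → Projection G A B
    trace B B⊆A with x ∈? B | y ∈? B
    ... | yes x∈B | yes y∈B = R₁₁ , R₁₁∈ , agree B⊆A (λ _ → x₁₁) (λ _ → x∈B) (λ _ → y₁₁) (λ _ → y∈B)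
    ... | yes x∈B | no  y∉B = R₁₀ , R₁₀∈ , agree B⊆A (λ _ → x₁₀) (λ _ → x∈B) (λ p → contradiction p y∉B) (λ p → contradiction p y₁₀)
    ... | no  x∉B | yes y∈B = R₀₁ , R₀₁∈ , agree B⊆A (λ p → contradiction p x∉B) (λ p → contradiction p x₀₁) (λ _ → y₀₁) (λ _ → y∈B)
    ... | no  x∉B | no  y∉B = R₀₀ , R₀₀∈ , agree B⊆A (λ p → contradiction p x∉B) (λ p → contradiction p x₀₀) (λ p → contradiction p y∉B) (λ p → contradiction p y₀₀)

primal-anchored : ∀ F → HasVCDimension F 1 →
                  (∀ A → A ∈ sets F → Nonempty (A ∩ A)) → ¬ (∃[ x ] ∃[ y ] PairHits (sets F) x y) →
                  Anchored (sets F)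
primal-anchored F vc nonempty ¬pair A A∈L _
  with maximal {_≼_ = λ x y → All (λ R → x ∈ˢ R → y ∈ˢ R) (sets F)}
         (λ xy yz → All.zipWith (λ (f , g) → g ∘ f) (xy , yz))
         (λ x y → all? (λ R → (x ∈? R) →-dec (y ∈? R)) (sets F))
         (filter (_∈? A) (allFin (points F)))
         (∈-filter⁺ (_∈? A) (∈-allFin _) (proj₁ (x∈p∩q⁻ A A (proj₂ (nonempty A A∈L)))))
... | y , y∈ , max = y , anchor
  where
  y∈A : y ∈ˢ A
  y∈A = proj₂ (∈-filter⁻ (_∈? A) {xs = allFin (points F)} y∈)

  anchor : ∀ R → R ∈ sets F → Minimal (sets F) R → Nonempty (R ∩ A) → y ∈ˢ R
  anchor R R∈L _ (x , x∈) with x∈p∩q⁻ R A x∈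
  ... | x∈R , x∈A = decidable-stable (y ∈? R) λ y∉R →
    not-all-patterns {G = F} vc (λ { refl → y∉R x∈R })
      (A , A∈L , x∈A , y∈A)
      (R , R∈L , x∈R , y∉R)
      (let S , S∈ , y∈S , x∉S = strict y∉R in S , S∈ , x∉S , y∈S)
      neither
    where
    -- If every set with `y` contained `x`, maximality of `y` would make every set with `x` contain
    -- `y`, and `R` is a counterexample.
    strict : y ∉ˢ R → ∃[ S ] S ∈ sets F × y ∈ˢ S × x ∉ˢ S
    strict y∉R with any? (λ S → (y ∈? S) ×-dec ¬? (x ∈? S)) (sets F)
    ... | yes some′ = find some′
    ... | no ¬some′ = contradiction
      (All.lookup (max (∈-filter⁺ (_∈? A) (∈-allFin x) x∈A)
        (All.tabulate λ {S} S∈ y∈S → decidable-stable (x ∈? S) λ x∉S → ¬some′ (lose S∈ (y∈S , x∉S)))) R∈L x∈R)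
      y∉R

    neither : ∃[ S ] S ∈ sets F × x ∉ˢ S × y ∉ˢ S
    neither with any? (λ S → ¬? (x ∈? S) ×-dec ¬? (y ∈? S)) (sets F)
    ... | yes some′ = find some′
    ... | no ¬some′ = contradiction (x , y , hits) ¬pair
      where
      hits : PairHits (sets F) x y
      hits S S∈ with x ∈? S | y ∈? S
      ... | yes x∈S | _       = inj₁ x∈S
      ... | no  _   | yes y∈S = inj₂ y∈S
      ... | no  x∉S | no  y∉S = contradiction (lose S∈ (x∉S , y∉S)) ¬some′

-- Anchors in dual VC-dimension 1

lookup-column : ∀ {A} {L : List (Subset n)} {x} (A∈L : A ∈ L) →
                lookup (Vec.map (λ B → lookup B x) (fromList L)) (index A∈L) ≡ lookup A x
lookup-column (here refl)  = refl
lookup-column (there A∈L) = lookup-column A∈L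

module _ (F : SetSystem) where

  -- In the dual system the set `A` becomes a point, namely its position `index A∈`.
  ∈-column⁺ : ∀ {A x} (A∈ : A ∈ sets F) → x ∈ˢ A → index A∈ ∈ˢ column F x
  ∈-column⁺ A∈ x∈A = lookup⇒[]= (index A∈) _ (trans (lookup-column A∈) ([]=⇒lookup x∈A))

  ∈-column⁻ : ∀ {A x} (A∈ : A ∈ sets F) → index A∈ ∈ˢ column F x → x ∈ˢ A
  ∈-column⁻ {A} {x} A∈ i∈ = lookup⇒[]= x A (trans (sym (lookup-column A∈)) ([]=⇒lookup i∈))

  column∈dual : ∀ x → column F x ∈ sets (dual F)
  column∈dual x = ∈-deduplicate⁺ _≟ˢ_ (∈-tabulate⁺ x)

  -- A point in each of the four regions cut out by `A` and `B` gives four columns, with all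
  -- patterns at the positions of `A` and `B`. These positions differ because the sets do.
  dual-not-all-patterns : HasVCDimension (dual F) 1 → ∀ {A B} → A ∈ sets F → B ∈ sets F → A ≢ B →
                          (∃[ x ] x ∈ˢ A × x ∈ˢ B) → (∃[ x ] x ∈ˢ A × x ∉ˢ B) →
                          (∃[ x ] x ∉ˢ A × x ∈ˢ B) → (∃[ x ] x ∉ˢ A × x ∉ˢ B) → ⊥
  dual-not-all-patterns vc A∈ B∈ A≢B (x₁₁ , a₁₁ , b₁₁) (x₁₀ , a₁₀ , b₁₀) (x₀₁ , a₀₁ , b₀₁) (x₀₀ , a₀₀ , b₀₀) =
    not-all-patterns {G = dual F} vc
      (λ i≡j → A≢B (trans (lookup-index A∈) (trans (cong (List.lookup (sets F)) (sym i≡j)) (sym (lookup-index B∈)))))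
      (column F x₁₁ , column∈dual x₁₁ , ∈-column⁺ A∈ a₁₁ , ∈-column⁺ B∈ b₁₁)
      (column F x₁₀ , column∈dual x₁₀ , ∈-column⁺ A∈ a₁₀ , b₁₀ ∘ ∈-column⁻ B∈)
      (column F x₀₁ , column∈dual x₀₁ , a₀₁ ∘ ∈-column⁻ A∈ , ∈-column⁺ B∈ b₀₁)
      (column F x₀₀ , column∈dual x₀₀ , a₀₀ ∘ ∈-column⁻ A∈ , b₀₀ ∘ ∈-column⁻ B∈)

dual-anchored : ∀ F → HasVCDimension (dual F) 1 →
                (∀ A → A ∈ sets F → Nonempty (A ∩ A)) → ¬ (∃[ x ] ∃[ y ] PairHits (sets F) x y) →
                Anchored (sets F)
dual-anchored F vc nonempty ¬pair A A∈L minA with nonempty A A∈L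
... | y , y∈ = y , anchor
  where
  L = sets F

  anchor : ∀ R → R ∈ L → Minimal L R → Nonempty (R ∩ A) → y ∈ˢ R
  anchor R R∈L minR (x , x∈) with A ≟ˢ R
  ... | yes refl = proj₁ (x∈p∩q⁻ A A y∈)
  ... | no  A≢R  = contradiction (a , r , hits) ¬pair
    where
    x∈R = proj₁ (x∈p∩q⁻ R A x∈)
    x∈A = proj₂ (x∈p∩q⁻ R A x∈)

    A∖R = minimal-⊈ A∈L minR (A≢R ∘ sym)
    a   = proj₁ A∖R
    a∈A = proj₁ (proj₂ A∖R)
    a∉R = proj₂ (proj₂ A∖R)

    R∖A = minimal-⊈ R∈L minA A≢R
    r   = proj₁ R∖A
    r∈R = proj₁ (proj₂ R∖A)
    r∉A = proj₂ (proj₂ R∖A)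

    cover : ∀ z → z ∉ˢ R → z ∈ˢ A
    cover z z∉R = decidable-stable (z ∈? A) λ z∉A →
      dual-not-all-patterns F vc A∈L R∈L A≢R (x , x∈A , x∈R) (a , a∈A , a∉R) (r , r∉A , r∈R) (z , z∉A , z∉R)

    hits : PairHits L a r
    -- It is enough to hit a minimal `C` inside `S`; minimality makes `C` and `R` incomparable once
    -- they differ.
    hits S S∈L with minimal-below S∈L
    ... | C , C∈L , minC , C⊆S with a ∈? C | r ∈? C
    ...   | yes a∈C | _       = inj₁ (C⊆S a∈C)
    ...   | no  _   | yes r∈C = inj₂ (C⊆S r∈C)
    ...   | no  a∉C | no  r∉C = contradiction (lose C∈L ((λ {z} → C⊆A {z}) , a , a∈A , a∉C)) minA
      where
      R≢C : R ≢ C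
      R≢C refl = r∉C r∈R

      C⊆A : C ⊆ A
      -- A point `z` in both `R` and `C` would complete the four patterns, with `a` outside both.
      C⊆A {z} z∈C = cover z λ z∈R → dual-not-all-patterns F vc R∈L C∈L R≢C (z , z∈R , z∈C)
        (minimal-⊈ R∈L minC (R≢C ∘ sym))
        (let c , c∈C , c∉R = minimal-⊈ C∈L minR R≢C in c , c∉R , c∈C)
        (a , a∉R , a∉C)

-- Correctness of the algorithm

-- Each branch may assume the outcome of the test, so later stages of the algorithm inherit the
-- failure of the earlier ones.
select-decides : ∀ {P Q : Set} {a b c} → Reflects P (truth a) →
                 (P → Reflects Q (truth b)) → (¬ P → Reflects Q (truth c)) →
                 Reflects Q (truth (select a b c))
select-decides {a = nil}   (ofⁿ ¬p) r s = s ¬p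
select-decides {a = _ ∙ _} (ofʸ p)  r s = r p

encodeBool-truth : ∀ x → select x (nil ∙ nil) nil ≡ encodeBool (truth x)
encodeBool-truth nil     = refl
encodeBool-truth (_ ∙ _) = refl

cells-rows : ∀ (P : List (Subset n)) → cells (rows P) ≡ length P
cells-rows []      = refl
cells-rows (_ ∷ P) = cong suc (cells-rows P)

Solution : SetSystem → ℕ → Set
Solution F k = ∃[ H ] IsHittingSet F H × ∣ H ∣ ≤ k

module _ (F : SetSystem) (k : ℕ) .{{_ : NonZero k}} where

  pair-hits : ∀ {x y} → PairHits (sets F) x y → IsHittingSet F (⁅ x ⁆ ∪ ⁅ y ⁆)
  pair-hits {x} {y} hits A A∈ with hits A A∈
  ... | inj₁ x∈A = x , x∈p∩q⁺ (x∈p∪q⁺ (inj₁ (x∈⁅x⁆ x)) , x∈A)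
  ... | inj₂ y∈A = y , x∈p∩q⁺ (x∈p∪q⁺ (inj₂ (x∈⁅x⁆ y)) , y∈A)

  point-yes : ∃[ x ] PairHits (sets F) x x → Solution F k
  point-yes (x , hits) = ⁅ x ⁆ ∪ ⁅ x ⁆ , pair-hits hits , (begin
    ∣ ⁅ x ⁆ ∪ ⁅ x ⁆ ∣ ≡⟨ cong ∣_∣ (∪-idem ⁅ x ⁆) ⟩
    ∣ ⁅ x ⁆ ∣         ≡⟨ ∣⁅x⁆∣≡1 x ⟩
    1                 ≤⟨ >-nonZero⁻¹ k ⟩
    k                 ∎)
    where open ≤-Reasoning

  pair-yes : ∃[ x ] ∃[ y ] PairHits (sets F) x y → 2 ≤ k → Solution F k
  pair-yes (x , y , hits) 2≤k = ⁅ x ⁆ ∪ ⁅ y ⁆ , pair-hits hits ,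
    ≤-trans (∣p∪q∣≤∣p∣+∣q∣ ⁅ x ⁆ ⁅ y ⁆) (≤-trans (≤-reflexive (cong₂ _+_ (∣⁅x⁆∣≡1 x) (∣⁅x⁆∣≡1 y))) 2≤k)

  pair-no : ¬ (∃[ x ] PairHits (sets F) x x) → ∃[ x ] ∃[ y ] PairHits (sets F) x y → Solution F k → 2 ≤ k
  pair-no ¬point (x , _) (H , hits , ∣H∣≤k) with 2 ≤? ∣ H ∣
  ... | yes 2≤∣H∣ = ≤-trans 2≤∣H∣ ∣H∣≤k
  ... | no  2≰∣H∣ with nonempty? H
  -- An empty hitting set means that there are no sets, so any point hits them all vacuously; the
  -- pair supplies one.
  ...   | no  empty     = contradiction (x , λ A A∈ → let z , z∈ = hits A A∈ in
                            contradiction (z , proj₁ (x∈p∩q⁻ H A z∈)) empty) ¬point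
  ...   | yes (h , h∈H) = contradiction (h , λ A A∈ → inj₁ (h∈ A A∈)) ¬point
    where
    h∈ : ∀ A → A ∈ sets F → h ∈ˢ A
    h∈ A A∈ with hits A A∈
    ... | z , z∈ with x∈p∩q⁻ H A z∈
    ...   | z∈H , z∈A with z ≟ᶠ h
    ...     | yes refl = z∈A
    ...     | no  z≢h  = contradiction (2≤∣p∣ h∈H z∈H z≢h) 2≰∣H∣

  packing-yes : Anchored (sets F) → ∀ {P} → Packing (sets F) P →
                (∀ A → A ∈ sets F → Minimal (sets F) A → Any (λ B → Nonempty (A ∩ B)) P) →
                length P ≤ k → Solution F k
  packing-yes anchored {P} pack meet ∣P∣≤k with anchors-hit anchored P (⊆sets pack) (minimals pack)
  ... | H , ∣H∣≤∣P∣ , hits = H , isHitting , ≤-trans ∣H∣≤∣P∣ ∣P∣≤k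
    where
    isHitting : IsHittingSet F H
    isHitting A A∈ with minimal-below A∈
    ... | B , B∈ , minB , B⊆A with hits B B∈ minB (meet B B∈ minB)
    ...   | z , z∈ = let z∈H , z∈B = x∈p∩q⁻ H B z∈ in z , x∈p∩q⁺ (z∈H , B⊆A z∈B)

  packing-no : ∀ {P} → Packing (sets F) P → Solution F k → length P ≤ k
  packing-no pack (H , hits , ∣H∣≤k) =
    ≤-trans (packing≤hitting (disjoint pack) (All.map (λ {A} → hits A) (⊆sets pack))) ∣H∣≤k

  input : Tree
  input = (unary (points F) ∙ rows (sets F)) ∙ encodeℕ k

  encodes : encodeSetSystem F ∙ encodeℕ k ≡ input
  encodes = cong (λ p → (p ∙ rows (sets F)) ∙ encodeℕ k) (encode-tabulate {n = points F} id)

  solve-decides : ((∀ A → A ∈ sets F → Nonempty (A ∩ A)) → ¬ (∃[ x ] ∃[ y ] PairHits (sets F) x y) → Anchored (sets F)) →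
                  Reflects (Solution F k) (truth (fn solve input))
  solve-decides anchored =
    select-decides (hasEmpty-decides (sets F))
      (λ some-empty → ofⁿ λ (H , hits , _) → let A , A∈ , empty = find some-empty
                                                 z , z∈ = hits A A∈
                                                 _ , z∈A = x∈p∩q⁻ H A z∈
                                             in empty (z , x∈p∩q⁺ (z∈A , z∈A)))
      λ none-empty → select-decides (hittingPoint-decides (sets F)) (ofʸ ∘ point-yes)
      λ ¬point → select-decides (hittingPair-decides (sets F))
        (λ pair → map-reflects (pair-yes pair) (pair-no ¬point pair) (atMost-decides k (nil ∙ nil ∙ nil)))
      λ ¬pair →
        let nonempty = λ A A∈ → decidable-stable (nonempty? (A ∩ A)) (none-empty ∘ lose A∈)
            P , eq , pack , meet = packing-computes (sets F) nonempty
            ∣P∣ = trans (cong cells eq) (cells-rows P)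
        in map-reflects
             (λ c≤k → packing-yes (anchored nonempty ¬pair) pack meet (subst (_≤ k) ∣P∣ c≤k))
             (λ yes → subst (_≤ k) (sym ∣P∣) (packing-no pack yes))
             (atMost-decides k (fn packing (unary (points F) ∙ rows (sets F))))

-- From procedures to polynomial-time solvability

module _ {Π : DecisionProblem} {Promise : DecisionProblem.Instance Π → Set} where

  open DecisionProblem Π

  solvable-by : ∀ p → (∀ I → Promise I → ∃[ b ] fn p (encode I) ≡ encodeBool b × Reflects (Yes I) b) →
                PolynomialTimeSolvableOn Π Promise
  solvable-by p correct with ⟦⟧-monomial (time p)
  ... | a , k , time≤ = record { auxiliaries = 0 ; body = code p } , suc a , k , decide
    where
    decide : ∀ I → Promise I → ∃[ b ] ∃[ t ] Runs (record { auxiliaries = 0 ; body = code p }) (encode I) (encodeBool b) t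
                                           × t ≤ suc a * size (encode I) ^ k + suc a × Reflects (Yes I) b
    decide I promised with correct I promised | runs p (encode I)
    ... | b , eq , reflects | t , run , t≤ =
      b , t , (_ , run , eq) , ≤-trans t≤ (≤-trans (time≤ _ (1≤size (encode I))) (m≤m+n _ (suc a))) , reflects

-- Correctness of `solve` speaks of truth values only, whereas the output must be exactly an encoded
-- Boolean.
solver : Procedure
solver = cond solve yes! no!

solvable : (Promise : SetSystem → Set) →
           (∀ F → Promise F → (∀ A → A ∈ sets F → Nonempty (A ∩ A)) →
              ¬ (∃[ x ] ∃[ y ] PairHits (sets F) x y) → Anchored (sets F)) →
           PolynomialTimeSolvableOn HittingSet (λ I → Promise (system I))
solvable Promise anchored = solvable-by solver
  λ { record { system = F ; bound = k } promised →
      truth (fn solve (encodeSetSystem F ∙ encodeℕ k)) , encodeBool-truth (fn solve (encodeSetSystem F ∙ encodeℕ k)) ,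
      subst (λ x → Reflects (Solution F k) (truth (fn solve x))) (sym (encodes F k)) (solve-decides F k (anchored F promised)) }

theorem5 : PolynomialTimeSolvableOn HittingSet (λ I → HasVCDimension (system I) 1) ×
    PolynomialTimeSolvableOn HittingSet (λ I → HasVCDimension (dual (system I)) 1)
theorem5 = solvable (λ F → HasVCDimension F 1) primal-anchored ,
           solvable (λ F → HasVCDimension (dual F) 1) dual-anchored
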